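{- Let $G=(V,E,w)$ be an undirected graph with nonnegative edge weights and $n=|V|$, and let $\alpha,\beta\in\mathbb{N}$. Then the set of values $$\{\mathrm{mincut}_G(K_{A,B}) : A,B\subseteq V \text{ disjoint},\ |A|=\alpha,\ |B|=\beta\}$$ has size $O_{\alpha,\beta}(n^{\alpha+\beta-1})$; consequently the family of $(\alpha,\beta)$-group-cut instances has redundancy factor $\Omega_{\alpha,\beta}(n)$. Furthermore, this bound is existentially tight: for all $\alpha,\beta$ and $n$ there is a graph $G$ on $n$ vertices for which this set has size $\Omega_{\alpha,\beta}(n^{\alpha+\beta-1})$.
   Context: A partition of $V$ is a collection of pairwise disjoint subsets of $V$ whose union is $V$; for a partition $\Pi$ and $v\in V$, $\Pi(v)$ is the part containing $v$. For a partition $\Pi$, $\mathrm{cut}_G(\Pi)=\sum_{uv\in E:\,\Pi(u)\neq\Pi(v)} w(uv)$. A demand graph $D$ is a set of unordered vertex pairs; a partition $\Pi$ agrees with $D$ if $\Pi(u)\ne\Pi(v)$ for every $uv\in D$, and $\mathrm{mincut}_G(D)=\min\{\mathrm{cut}_G(\Pi): \Pi \text{ agrees with } D\}$. For disjoint $A,B\subseteq V$, $K_{A,B}$ denotes the demand graph consisting of all pairs $ab$ with $a\in A$, $b\in B$ (so $\mathrm{mincut}_G(K_{A,B})$ is the minimum weight of an edge set separating every vertex of $A$ from every vertex of $B$). The redundancy factor of a family $\mathcal D$ of demand graphs is $|\mathcal D|$ divided by the number of distinct values in $\{\mathrm{mincut}_G(D):D\in\mathcal D\}$. $O_{\gamma},\Omega_\gamma$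 hide factors depending only on $\gamma$.
   Formalization: The nonnegative edge weights are taken rational rather than real; α and β are taken to be at least 1, and the O and Ω bounds are stated for all sufficiently large n (depending on α, β). -}

module Defs where

open import Data.Nat as ℕ using (ℕ; zero; suc)
open import Data.Fin as Fin using (Fin; zero; suc)
open import Data.Fin.Properties as FinP using ()
open import Data.Fin.Subset using (Subset; _∈_; _∉_; ∣_∣)
open import Data.Rational as ℚ using (ℚ; 0ℚ)
open import Data.Bool using (Bool; if_then_else_; _∧_; not)
open import Data.List using (List; length)
open import Data.List.Membership.Propositional using () renaming (_∈_ to _∈ₗ_)
open import Data.List.Relation.Unary.Unique.Propositional using (Unique)
open import Data.Product using (Σ; _×_; ∃)
open import Function using (_∘_; _⇔_)
open import Relation.Nullary using (¬_; does)
open import Relation.Binary.PropositionalEquality using (_≡_; _≢_)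

-- Undirected graph on vertex set V = Fin n with nonnegative (rational) edge
-- weights, given by a symmetric weight matrix; a non-edge has weight 0.
record WGraph (n : ℕ) : Set where
  field
    w      : Fin n → Fin n → ℚ
    w-sym  : ∀ u v → w u v ≡ w v u
    w-nonneg : ∀ u v → 0ℚ ℚ.≤ w u v
open WGraph public

-- A partition Π of V is represented by a labelling Π : V → Fin n
-- (Π(u) = Π(v) iff u, v lie in the same part); every partition of an
-- n-element set has at most n parts, so every partition arises this way.
Partition : ℕ → Set
Partition n = Fin n → Fin n

sumFin : ∀ {n} → (Fin n → ℚ) → ℚ
sumFin {zero}  f = 0ℚ
sumFin {suc n} f = f zero ℚ.+ sumFin (f ∘ suc)

cut : ∀ {n} → WGraph n → Partition n → ℚ
cut G Π = sumFin λ u → sumFin λ v →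
  if does (u FinP.<? v) ∧ not (does (Π u FinP.≟ Π v)) then w G u v else 0ℚ

-- Demand graph: a (symmetric reading of a) set of vertex pairs.
DemandGraph : ℕ → Set₁
DemandGraph n = Fin n → Fin n → Set

Agrees : ∀ {n} → DemandGraph n → Partition n → Set
Agrees D Π = ∀ u v → D u v → Π u ≢ Π v

IsMinCut : ∀ {n} → WGraph n → DemandGraph n → ℚ → Set
IsMinCut G D m =
  (Σ (Partition _) λ Π → Agrees D Π × cut G Π ≡ m) ×
  (∀ Π → Agrees D Π → m ℚ.≤ cut G Π)

K : ∀ {n} → Subset n → Subset n → DemandGraph n
K A B u v = (u ∈ A) × (v ∈ B)

Disjoint : ∀ {n} → Subset n → Subset n → Set
Disjoint A B = ∀ x → x ∈ A → x ∉ B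

Instance : ∀ {n} → ℕ → ℕ → Subset n × Subset n → Set
Instance α β (A Data.Product., B) = Disjoint A B × ∣ A ∣ ≡ α × ∣ B ∣ ≡ β

Values : ∀ {n} → WGraph n → ℕ → ℕ → ℚ → Set
Values {n} G α β m =
  Σ (Subset n × Subset n) λ AB →
    Instance α β AB × IsMinCut G (K (Data.Product.proj₁ AB) (Data.Product.proj₂ AB)) m

HasSize : ∀ {X : Set} → (X → Set) → ℕ → Set
HasSize {X} P k = Σ (List X) λ xs → Unique xs × length xs ≡ k × (∀ x → P x ⇔ x ∈ₗ xs)

{-# OPTIONS --safe #-}
module Submission where

-- Upper bound.  Merging parts turns a minimum (A,B)-cut into a two-colouring, and a two-colouring x
-- separates A from B as soon as it separates the α + β - 1 edges uv of a spanning tree of K_{A,B}, that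
-- is, as soon as the product of the linear forms x_u + x_v over the field with two elements is 1.  For
-- distinct values m_i with demands D_i and optimal colourings x_i, the matrix [x_i separates D_j]
-- vanishes when m_j > m_i, so it is unitriangular, while its rank is at most n^(α+β-1).
--
-- Redundancy.  Cut V into α + β blocks of size about n / (α + β); choosing one vertex from each block
-- gives Ω(n^(α+β)) instances.
--
-- Tightness.  Take a broom: a path hanging from a root, α - 1 blocks of leaves at the far end of the
-- path, and β - 1 blocks of leaves at the root.  Number the path before the leaves and give the edge
-- above the v-th vertex weight 2^(n-1-v).  Let A consist of the root and one leaf per far
-- block, and B of one path vertex and one leaf per near block.  The minimum cut consists of the edges
-- above the terminals other than the root, so the binary expansion of its value determines them.

open import Defs
open import Algebra.Bundles using (CommutativeMonoid; CommutativeRing)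
import Algebra.Properties.CommutativeMonoid.Sum as CommutativeMonoidSum
import Algebra.Properties.CommutativeSemigroup as CommutativeSemigroupProperties
import Algebra.Properties.Group as GroupProperties
import Algebra.Properties.Semiring.Sum as SemiringSum
open import Data.Bool using (Bool; true; false; if_then_else_; not; _∧_; _xor_)
import Data.Bool.Properties as Bool
open import Data.Fin as Fin using (Fin; zero; suc; toℕ; fromℕ; inject₁; punchIn; splitAt; join; _↑ˡ_; _↑ʳ_; combine; remQuot; funToFin; finToFun)
open import Data.Fin.Induction using (spo-wellFounded)
import Data.Fin.Properties as Fin
open import Data.Fin.Subset using (Subset; _∈_; ∣_∣; inside; outside; ⊥; ⁅_⁆)
open import Data.Fin.Subset.Properties using (_∈?_; anySubset?; ∣⊥∣≡0; ∣⁅x⁆∣≡1; x∈⁅x⁆; x∈⁅y⁆⇒x≡y; ∉⊥)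
open import Data.List as List using (List; length; map; filter; deduplicate; allFin)
open import Data.List.Membership.Propositional using () renaming (_∈_ to _∈ₗ_)
open import Data.List.Membership.Propositional.Properties using (∈-lookup; ∈-map⁺; ∈-filter⁺; ∈-filter⁻; ∈-allFin; ∈-deduplicate⁺; ∈-deduplicate⁻)
import Data.List.Relation.Unary.All as All
open import Data.List.Relation.Unary.AllPairs using (_∷_)
open import Data.List.Relation.Unary.Any using (index)
open import Data.List.Relation.Unary.Any.Properties using (lookup-index)
open import Data.List.Relation.Unary.Unique.DecPropositional.Properties using (deduplicate-!)
open import Data.List.Relation.Unary.Unique.Propositional using (Unique)
open import Data.Nat as ℕ using (ℕ; zero; suc; _+_; _*_; _∸_; _^_; _≤_; _<_; z≤n; s≤s; _/_; _%_)
open import Data.Nat.DivMod using (m≡m%n+[m/n]*n; m%n<n)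
import Data.Nat.Properties as ℕ
open import Data.Product using (Σ; ∃; _×_; _,_; proj₁; proj₂; uncurry)
open import Data.Rational as ℚ using (ℚ; 0ℚ; 1ℚ)
import Data.Rational.Properties as ℚ
open import Data.Sum using (_⊎_; inj₁; inj₂)
open import Data.Vec using ([]; _∷_; _++_; concat; tabulate; lookup; here; there)
open import Data.Vec.Properties using (lookup-++ˡ; lookup-++ʳ; lookup-concat; lookup∘tabulate; []=⇒lookup; lookup⇒[]=)
open import Function using (_∘_; Injective; Equivalence; Injection; Inverse; mk⇔)
open import Function.Properties.Inverse using (↔⇒↣; ↔-sym)
open import Induction.WellFounded using (Acc; acc; WellFounded)
import Relation.Binary.Construct.On as On
open import Relation.Binary.PropositionalEquality using (_≡_; _≢_; _≗_; refl; sym; trans; cong; cong₂; subst; module ≡-Reasoning)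
open import Relation.Nullary using (Dec; yes; no; does; contradiction; _×-dec_; _→-dec_; ¬?)
open import Relation.Nullary.Decidable using (dec-true; dec-false; map′)
open import Relation.Unary using (Decidable)

-- Sums over the field with two elements.

open CommutativeSemigroupProperties (CommutativeMonoid.commutativeSemigroup Bool.∧-commutativeMonoid) using (interchange)
open CommutativeRing Bool.xor-∧-commutativeRing using (semiring; +-commutativeMonoid; +-group)
open GroupProperties +-group using (∙-cancelʳ)

-- Opaque, so that unification can read off the summand.
opaque
  private
    module Xor = CommutativeMonoidSum +-commutativeMonoid
    module Ring = SemiringSum semiring

  ⨁ : ∀ {n} → (Fin n → Bool) → Bool
  ⨁ = Xor.sum

  ⨁-zero : (f : Fin 0 → Bool) → ⨁ f ≡ false
  ⨁-zero f = refl

  ⨁-suc : ∀ {n} (f : Fin (suc n) → Bool) → ⨁ f ≡ f zero xor ⨁ (f ∘ suc)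
  ⨁-suc f = refl

  ⨁-cong : ∀ {n} {f g : Fin n → Bool} → f ≗ g → ⨁ f ≡ ⨁ g
  ⨁-cong = Xor.sum-cong-≗

  ⨁-false : ∀ n → ⨁ {n} (λ _ → false) ≡ false
  ⨁-false n = Xor.sum-replicate-zero n

  ⨁-remove : ∀ {n} i (f : Fin (suc n) → Bool) → ⨁ f ≡ f i xor ⨁ (f ∘ punchIn i)
  ⨁-remove i f = Xor.sum-remove f

  ⨁-xor : ∀ {n} (f g : Fin n → Bool) → ⨁ (λ i → f i xor g i) ≡ ⨁ f xor ⨁ g
  ⨁-xor = Xor.∑-distrib-+

  ⨁-swap : ∀ {m n} (f : Fin m → Fin n → Bool) → ⨁ (λ i → ⨁ λ j → f i j) ≡ ⨁ λ j → ⨁ λ i → f i j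
  ⨁-swap = Xor.∑-comm

  ∧-distribˡ-⨁ : ∀ {n} x (f : Fin n → Bool) → x ∧ ⨁ f ≡ ⨁ λ i → x ∧ f i
  ∧-distribˡ-⨁ = Ring.*-distribˡ-sum

  ∧-distribʳ-⨁ : ∀ {n} x (f : Fin n → Bool) → ⨁ f ∧ x ≡ ⨁ λ i → f i ∧ x
  ∧-distribʳ-⨁ = Ring.*-distribʳ-sum

⨁-determines-term : ∀ {k} {f g : Fin k → Bool} i → (∀ j → j ≢ i → f j ≡ g j) → ⨁ f ≡ ⨁ g → f i ≡ g i
⨁-determines-term {suc k} {f} {g} i f≡g eq = ∙-cancelʳ (⨁ (f ∘ punchIn i)) _ _ (begin
  f i xor ⨁ (f ∘ punchIn i)  ≡⟨ ⨁-remove i f ⟨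
  ⨁ f                        ≡⟨ eq ⟩
  ⨁ g                        ≡⟨ ⨁-remove i g ⟩
  g i xor ⨁ (g ∘ punchIn i)  ≡⟨ cong (g i xor_) (⨁-cong λ j → f≡g _ (Fin.punchInᵢ≢i i j)) ⟨
  g i xor ⨁ (f ∘ punchIn i)  ∎)
  where open ≡-Reasoning

⨁-++ : ∀ m {n} (f : Fin (m + n) → Bool) → ⨁ f ≡ ⨁ (λ i → f (i ↑ˡ n)) xor ⨁ (λ j → f (m ↑ʳ j))
⨁-++ zero f rewrite ⨁-zero (λ i → f (i ↑ˡ _)) = refl
⨁-++ (suc m) {n} f = begin
  ⨁ f                                                                            ≡⟨ ⨁-suc f ⟩
  f zero xor ⨁ (f ∘ suc)                                                         ≡⟨ cong (f zero xor_) (⨁-++ m (f ∘ suc)) ⟩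
  f zero xor (⨁ (λ i → f (suc i ↑ˡ n)) xor ⨁ (λ j → f (suc m ↑ʳ j)))             ≡⟨ Bool.xor-assoc (f zero) _ _ ⟨
  (f zero xor ⨁ (λ i → f (suc i ↑ˡ n))) xor ⨁ (λ j → f (suc m ↑ʳ j))
    ≡⟨ cong (_xor ⨁ (λ j → f (suc m ↑ʳ j))) (⨁-suc λ i → f (i ↑ˡ n)) ⟨
  ⨁ (λ i → f (i ↑ˡ n)) xor ⨁ (λ j → f (suc m ↑ʳ j))                             ∎
  where open ≡-Reasoning

⨁-combine : ∀ m {n} (f : Fin (m * n) → Bool) → ⨁ f ≡ ⨁ λ i → ⨁ λ j → f (combine {m} {n} i j)
⨁-combine zero f = trans (⨁-zero f) (sym (⨁-zero _))
⨁-combine (suc m) {n} f = begin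
  ⨁ f                                                             ≡⟨ ⨁-++ n f ⟩
  ⨁ (λ j → f (j ↑ˡ m * n)) xor ⨁ (λ k → f (n ↑ʳ k))
    ≡⟨ cong (⨁ (λ j → f (j ↑ˡ m * n)) xor_) (⨁-combine m λ k → f (n ↑ʳ k)) ⟩
  ⨁ (λ j → f (combine {suc m} zero j)) xor ⨁ (λ i → ⨁ λ j → f (combine {suc m} (suc i) j))
                                                                  ≡⟨ ⨁-suc (λ i → ⨁ λ j → f (combine {suc m} i j)) ⟨
  ⨁ (λ i → ⨁ λ j → f (combine {suc m} i j))                       ∎
  where open ≡-Reasoning

-- Rank over the field with two elements.
record RankAtMost {I J : Set} (d : ℕ) (M : I → J → Bool) : Set where
  field
    left  : I → Fin d → Bool
    right : Fin d → J → Bool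
    factorisation : ∀ i j → M i j ≡ ⨁ λ t → left i t ∧ right t j
open RankAtMost

-- A product of two sums expands into a sum over pairs of indices, and each term regroups into a row
-- factor and a column factor; hence the ranks multiply.
rank-∧ : ∀ {I J : Set} {d e} {M N : I → J → Bool} → RankAtMost d M → RankAtMost e N →
  RankAtMost (d * e) λ i j → M i j ∧ N i j
rank-∧ {d = d} {e} {M} {N} R S = record
  { left = λ i t → L i (remQuot e t)
  ; right = λ t j → P (remQuot e t) j
  ; factorisation = λ i j → begin
      M i j ∧ N i j
        ≡⟨ cong₂ _∧_ (factorisation R i j) (factorisation S i j) ⟩
      ⨁ (λ t → left R i t ∧ right R t j) ∧ ⨁ (λ u → left S i u ∧ right S u j)
        ≡⟨ ∧-distribʳ-⨁ _ _ ⟩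
      ⨁ (λ t → (left R i t ∧ right R t j) ∧ ⨁ (λ u → left S i u ∧ right S u j))
        ≡⟨ ⨁-cong (λ t → trans (∧-distribˡ-⨁ (left R i t ∧ right R t j) _)
             (⨁-cong λ u → interchange (left R i t) _ _ _)) ⟩
      ⨁ (λ t → ⨁ λ u → L i (t , u) ∧ P (t , u) j)
        ≡⟨ ⨁-cong (λ t → ⨁-cong λ u →
             cong (λ z → L i z ∧ P z j) (sym (Fin.remQuot-combine t u))) ⟩
      ⨁ (λ t → ⨁ λ u → L i (remQuot e (combine t u)) ∧ P (remQuot e (combine t u)) j)
        ≡⟨ ⨁-combine d _ ⟨
      ⨁ (λ t → L i (remQuot e t) ∧ P (remQuot {d} e t) j) ∎
  }
  where
  open ≡-Reasoning
  L : _ → Fin d × Fin e → Bool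
  L i (t , u) = left R i t ∧ left S i u
  P : Fin d × Fin e → _ → Bool
  P (t , u) j = right R t j ∧ right S u j

⋀ : ∀ {s} → (Fin s → Bool) → Bool
⋀ {zero}  f = true
⋀ {suc s} f = f zero ∧ ⋀ (f ∘ suc)

⋀-true⁺ : ∀ {s} {f : Fin s → Bool} → (∀ l → f l ≡ true) → ⋀ f ≡ true
⋀-true⁺ {zero}  h = refl
⋀-true⁺ {suc s} h rewrite h zero = ⋀-true⁺ (h ∘ suc)

⋀-true⁻ : ∀ {s} {f : Fin s → Bool} → ⋀ f ≡ true → ∀ l → f l ≡ true
⋀-true⁻ {suc s} {f} h l with f zero in eq
⋀-true⁻ {suc s} {f} h zero    | true = eq
⋀-true⁻ {suc s} {f} h (suc l) | true = ⋀-true⁻ h l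

rank-⋀ : ∀ {I J : Set} {d} s {M : Fin s → I → J → Bool} → (∀ l → RankAtMost d (M l)) →
  RankAtMost (d ^ s) λ i j → ⋀ λ l → M l i j
-- The empty conjunction gives the all-true matrix, of rank at most `d ^ 0`, which is 1.
rank-⋀ zero R = record
  { left = λ _ _ → true
  ; right = λ _ _ → true
  ; factorisation = λ _ _ → sym (trans (⨁-suc _) (cong not (⨁-zero _)))
  }
rank-⋀ (suc s) R = rank-∧ (R zero) (rank-⋀ s (R ∘ suc))

⨁-δ : ∀ {n} (x : Fin n → Bool) u → ⨁ (λ v → x v ∧ does (v Fin.≟ u)) ≡ x u
⨁-δ {suc n} x zero = begin
  ⨁ (λ v → x v ∧ does (v Fin.≟ zero))           ≡⟨ ⨁-suc _ ⟩
  (x zero ∧ true) xor ⨁ (λ v → x (suc v) ∧ false)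
    ≡⟨ cong₂ _xor_ (Bool.∧-identityʳ (x zero)) (trans (⨁-cong λ v → Bool.∧-zeroʳ (x (suc v))) (⨁-false n)) ⟩
  x zero xor false                               ≡⟨ Bool.xor-identityʳ (x zero) ⟩
  x zero                                         ∎
  where open ≡-Reasoning
⨁-δ {suc n} x (suc u) = begin
  ⨁ (λ v → x v ∧ does (v Fin.≟ suc u))           ≡⟨ ⨁-suc _ ⟩
  (x zero ∧ false) xor ⨁ (λ v → x (suc v) ∧ does (v Fin.≟ u))
    ≡⟨ cong₂ _xor_ (Bool.∧-zeroʳ (x zero)) (⨁-δ (x ∘ suc) u) ⟩
  x (suc u)                                      ∎
  where open ≡-Reasoning

-- Evaluation at a vertex is the scalar product with its indicator vector. The row factor is thus
-- the colouring itself, and the bound is the number of vertices, however many rows and columns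
-- there are.
rank-xor-eval : ∀ {I J : Set} {n} (x : I → Fin n → Bool) (u v : J → Fin n) →
  RankAtMost n λ i j → x i (u j) xor x i (v j)
rank-xor-eval x u v = record
  { left = x
  ; right = λ t j → does (t Fin.≟ u j) xor does (t Fin.≟ v j)
  ; factorisation = λ i j → sym (begin
      ⨁ (λ t → x i t ∧ (does (t Fin.≟ u j) xor does (t Fin.≟ v j)))
        ≡⟨ ⨁-cong (λ t → Bool.∧-distribˡ-xor (x i t) _ _) ⟩
      ⨁ (λ t → (x i t ∧ does (t Fin.≟ u j)) xor (x i t ∧ does (t Fin.≟ v j)))
        ≡⟨ ⨁-xor (λ t → x i t ∧ does (t Fin.≟ u j)) _ ⟩
      ⨁ (λ t → x i t ∧ does (t Fin.≟ u j)) xor ⨁ (λ t → x i t ∧ does (t Fin.≟ v j))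
        ≡⟨ cong₂ _xor_ (⨁-δ (x i) (u j)) (⨁-δ (x i) (v j)) ⟩
      x i (u j) xor x i (v j) ∎)
  }
  where open ≡-Reasoning

-- Unitriangular matrices and their rank.

-- Well-founded induction solves for one coordinate at a time: in row `i` the terms at `j ≢ i`
-- agree, since either the entry vanishes or `j ⊏ i` is already settled, so the diagonal terms agree
-- as well.
unitriangular-injective : ∀ {k} {_⊏_ : Fin k → Fin k → Set} → WellFounded _⊏_ → (M : Fin k → Fin k → Bool) →
  (∀ i → M i i ≡ true) → (∀ i j → M i j ≡ true → j ≢ i → j ⊏ i) →
  ∀ {y z : Fin k → Bool} → (∀ i → ⨁ (λ j → M i j ∧ y j) ≡ ⨁ (λ j → M i j ∧ z j)) → y ≗ z
unitriangular-injective {k} {_⊏_} wf M diag tri {y} {z} My≡Mz i = go (wf i)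
  where
  go : ∀ {i} → Acc _⊏_ i → y i ≡ z i
  go {i} (acc rs) = begin
    y i          ≡⟨ cong (_∧ y i) (diag i) ⟨
    M i i ∧ y i  ≡⟨ ⨁-determines-term i off (My≡Mz i) ⟩
    M i i ∧ z i  ≡⟨ cong (_∧ z i) (diag i) ⟩
    z i          ∎
    where
    open ≡-Reasoning
    off : ∀ j → j ≢ i → M i j ∧ y j ≡ M i j ∧ z j
    off j j≢i with M i j in eq
    ... | false = refl
    ... | true  = go (rs (tri i j eq j≢i))

funToFin-injective : ∀ {m n} {f g : Fin m → Fin n} → funToFin f ≡ funToFin g → f ≗ g
funToFin-injective {f = f} {g} eq i =
  trans (sym (Fin.finToFun-funToFin f i)) (trans (cong (λ c → finToFun c i) eq) (Fin.finToFun-funToFin g i))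

funToFin-cong : ∀ {m n} {f g : Fin m → Fin n} → f ≗ g → funToFin f ≡ funToFin g
funToFin-cong {zero}  f≗g = refl
funToFin-cong {suc m} f≗g = cong₂ combine (f≗g zero) (funToFin-cong (f≗g ∘ suc))

finToFun-injective : ∀ {m n} {c d : Fin (m ^ n)} → finToFun {m} {n} c ≗ finToFun d → c ≡ d
finToFun-injective {m} {n} {c} {d} eq =
  trans (sym (Fin.funToFin-finToFin {n} {m} c)) (trans (funToFin-cong {n} {m} eq) (Fin.funToFin-finToFin {n} {m} d))

2^-cancel-≤ : ∀ {k d} → 2 ^ k ≤ 2 ^ d → k ≤ d
2^-cancel-≤ {k} {d} le with k ℕ.≤? d
... | yes k≤d = k≤d
... | no k≰d = contradiction (ℕ.^-monoʳ-< 2 (s≤s (s≤s z≤n)) (ℕ.≰⇒> k≰d)) (ℕ.≤⇒≯ le)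

-- A linear map Bool ^ k → Bool ^ d cannot be injective when d < k, by counting.
unitriangular⇒size≤rank : ∀ {k d} {_⊏_ : Fin k → Fin k → Set} → WellFounded _⊏_ → (M : Fin k → Fin k → Bool) →
  (∀ i → M i i ≡ true) → (∀ i j → M i j ≡ true → j ≢ i → j ⊏ i) → RankAtMost d M → k ≤ d
unitriangular⇒size≤rank {k} {d} wf M diag tri R = 2^-cancel-≤ (Fin.injective⇒≤ {f = Φ} Φ-injective)
  where
  open ≡-Reasoning
  vec : Fin (2 ^ k) → Fin k → Bool
  vec c j = Inverse.to Fin.2↔Bool (finToFun c j)
  φ : (Fin k → Bool) → Fin d → Bool
  φ y t = ⨁ λ j → right R t j ∧ y j
  Φ : Fin (2 ^ k) → Fin (2 ^ d)
  Φ c = funToFin (Inverse.from Fin.2↔Bool ∘ φ (vec c))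
  -- By associativity of the matrix product, `M` acts through `φ`, so vectors with equal images
  -- under `φ` have equal images under `M`.
  M-via-φ : ∀ y i → ⨁ (λ j → M i j ∧ y j) ≡ ⨁ (λ t → left R i t ∧ φ y t)
  M-via-φ y i = begin
    ⨁ (λ j → M i j ∧ y j)
      ≡⟨ ⨁-cong (λ j → trans (cong (_∧ y j) (factorisation R i j)) (∧-distribʳ-⨁ (y j) _)) ⟩
    ⨁ (λ j → ⨁ λ t → (left R i t ∧ right R t j) ∧ y j)
      ≡⟨ ⨁-swap (λ j t → (left R i t ∧ right R t j) ∧ y j) ⟩
    ⨁ (λ t → ⨁ λ j → (left R i t ∧ right R t j) ∧ y j)
      ≡⟨ ⨁-cong (λ t → trans (⨁-cong λ j → Bool.∧-assoc (left R i t) _ _)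
           (sym (∧-distribˡ-⨁ (left R i t) _))) ⟩
    ⨁ (λ t → left R i t ∧ φ y t) ∎
  Φ-injective : Injective _≡_ _≡_ Φ
  Φ-injective {c} {c′} eq = finToFun-injective {2} {k} λ j →
    Injection.injective (↔⇒↣ Fin.2↔Bool) (unitriangular-injective wf M diag tri {vec c} {vec c′} same j)
    where
    same : ∀ i → ⨁ (λ j → M i j ∧ vec c j) ≡ ⨁ (λ j → M i j ∧ vec c′ j)
    same i = begin
      ⨁ (λ j → M i j ∧ vec c j)          ≡⟨ M-via-φ (vec c) i ⟩
      ⨁ (λ t → left R i t ∧ φ (vec c) t)
        ≡⟨ ⨁-cong (λ t → cong (left R i t ∧_) (Injection.injective (↔⇒↣ (↔-sym Fin.2↔Bool)) (funToFin-injective eq t))) ⟩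
      ⨁ (λ t → left R i t ∧ φ (vec c′) t)  ≡⟨ M-via-φ (vec c′) i ⟨
      ⨁ (λ j → M i j ∧ vec c′ j)         ∎

-- Cuts under merging of parts.

sumFin-mono : ∀ {n} {f g : Fin n → ℚ} → (∀ i → f i ℚ.≤ g i) → sumFin f ℚ.≤ sumFin g
sumFin-mono {zero}  f≤g = ℚ.≤-refl
sumFin-mono {suc n} f≤g = ℚ.+-mono-≤ (f≤g zero) (sumFin-mono (f≤g ∘ suc))

sumFin-cong : ∀ {n} {f g : Fin n → ℚ} → f ≗ g → sumFin f ≡ sumFin g
sumFin-cong {zero}  f≗g = refl
sumFin-cong {suc n} f≗g = cong₂ ℚ._+_ (f≗g zero) (sumFin-cong (f≗g ∘ suc))

-- Merging parts only turns cut edges into uncut ones, and the weights lost are nonnegative.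
cut-coarser : ∀ {n} (G : WGraph n) {Π Π′ : Partition n} → (∀ u v → Π u ≡ Π v → Π′ u ≡ Π′ v) → cut G Π′ ℚ.≤ cut G Π
cut-coarser G {Π} {Π′} coarse = sumFin-mono λ u → sumFin-mono λ v → term u v
  where
  term : ∀ u v → (if does (u Fin.<? v) ∧ not (does (Π′ u Fin.≟ Π′ v)) then w G u v else 0ℚ)
           ℚ.≤ (if does (u Fin.<? v) ∧ not (does (Π u Fin.≟ Π v)) then w G u v else 0ℚ)
  term u v with does (u Fin.<? v) | Π u Fin.≟ Π v | Π′ u Fin.≟ Π′ v
  ... | false | _     | _      = ℚ.≤-refl
  ... | true  | yes e | yes e′ = ℚ.≤-refl
  ... | true  | yes e | no ne  = contradiction (coarse u v e) ne
  ... | true  | no _  | yes _  = w-nonneg G u v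
  ... | true  | no _  | no _   = ℚ.≤-refl

-- Two-colourings and spanning demands.

elements : ∀ {n} (A : Subset n) → Fin ∣ A ∣ → Fin n
elements (outside ∷ A) i       = suc (elements A i)
elements (inside  ∷ A) zero    = zero
elements (inside  ∷ A) (suc i) = suc (elements A i)

elements-∈ : ∀ {n} (A : Subset n) i → elements A i ∈ A
elements-∈ (outside ∷ A) i       = there (elements-∈ A i)
elements-∈ (inside  ∷ A) zero    = here
elements-∈ (inside  ∷ A) (suc i) = there (elements-∈ A i)

elements-surjective : ∀ {n} (A : Subset n) {v} → v ∈ A → ∃ λ i → elements A i ≡ v
elements-surjective (inside  ∷ A) here      = zero , refl
elements-surjective (outside ∷ A) (there p) with i , e ← elements-surjective A p = i , cong suc e
elements-surjective (inside  ∷ A) (there p) with i , e ← elements-surjective A p = suc i , cong suc e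

≢⇒xor : ∀ {x y} → x ≢ y → x xor y ≡ true
≢⇒xor {false} {false} ne = contradiction refl ne
≢⇒xor {false} {true}  ne = refl
≢⇒xor {true}  {false} ne = refl
≢⇒xor {true}  {true}  ne = contradiction refl ne

xor⇒≢ : ∀ {x y} → x xor y ≡ true → x ≢ y
xor⇒≢ {false} () refl
xor⇒≢ {true} () refl

-- Along `a`, `b₀`, `a₀`, `b` the colour changes three times; with two colours an odd number of
-- changes leaves the ends different.
zigzag : ∀ {a b a₀ b₀ : Bool} → a ≢ b₀ → a₀ ≢ b₀ → a₀ ≢ b → a ≢ b
zigzag {false} {false} {a₀} {false} p q r = contradiction refl p
zigzag {false} {false} {false} {true} p q r = contradiction refl r
zigzag {false} {false} {true} {true} p q r = contradiction refl q
zigzag {false} {true} p q r = λ ()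
zigzag {true} {false} p q r = λ ()
zigzag {true} {true} {a₀} {true} p q r = contradiction refl p
zigzag {true} {true} {false} {false} p q r = contradiction refl q
zigzag {true} {true} {true} {false} p q r = contradiction refl r

-- A complete bipartite demand graph has a spanning tree of α + β - 1 demands (a double star), and a
-- two-colouring that separates the tree edges separates all demands.
record SpanningDemands {n} (s : ℕ) (A B : Subset n) : Set where
  field
    end₁ end₂ : Fin s → Fin n
    end₁-∈ : ∀ l → end₁ l ∈ A
    end₂-∈ : ∀ l → end₂ l ∈ B
    spanning : (x : Fin n → Bool) → (∀ l → x (end₁ l) ≢ x (end₂ l)) → ∀ {a b} → a ∈ A → b ∈ B → x a ≢ x b
open SpanningDemands

-- The centres are the first elements of `A` and `B`. The first `α` edges join the other elements of
-- `A` to the centre of `B`; the remaining `suc β` join the centre of `A` to all of `B`, and the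
-- edge between the centres is among these.
double-star : ∀ {n} α β (A B : Subset n) → ∣ A ∣ ≡ suc α → ∣ B ∣ ≡ suc β → SpanningDemands (α + suc β) A B
double-star {n} α β A B ∣A∣ ∣B∣ = record
  { end₁ = proj₁ ∘ pair
  ; end₂ = proj₂ ∘ pair
  ; end₁-∈ = λ l → case₁ (splitAt α l)
  ; end₂-∈ = λ l → case₂ (splitAt α l)
  ; spanning = λ x sep p q → span x sep (surj A ∣A∣ p) (surj B ∣B∣ q)
  }
  where
  enum : ∀ (C : Subset n) {k} → ∣ C ∣ ≡ k → Fin k → Fin n
  enum C refl = elements C
  enum-∈ : ∀ (C : Subset n) {k} (e : ∣ C ∣ ≡ k) i → enum C e i ∈ C
  enum-∈ C refl = elements-∈ C
  surj : ∀ (C : Subset n) {k} (e : ∣ C ∣ ≡ k) {v} → v ∈ C → ∃ λ i → enum C e i ≡ v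
  surj C refl = elements-surjective C
  pair′ : Fin α ⊎ Fin (suc β) → Fin n × Fin n
  pair′ (inj₁ i) = enum A ∣A∣ (suc i) , enum B ∣B∣ zero
  pair′ (inj₂ j) = enum A ∣A∣ zero , enum B ∣B∣ j
  pair : Fin (α + suc β) → Fin n × Fin n
  pair l = pair′ (splitAt α l)
  case₁ : ∀ z → proj₁ (pair′ z) ∈ A
  case₁ (inj₁ i) = enum-∈ A ∣A∣ (suc i)
  case₁ (inj₂ j) = enum-∈ A ∣A∣ zero
  case₂ : ∀ z → proj₂ (pair′ z) ∈ B
  case₂ (inj₁ i) = enum-∈ B ∣B∣ zero
  case₂ (inj₂ j) = enum-∈ B ∣B∣ j
  span : (x : Fin n → Bool) → (∀ l → x (proj₁ (pair l)) ≢ x (proj₂ (pair l))) →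
    ∀ {a b} → (∃ λ i → enum A ∣A∣ i ≡ a) → (∃ λ j → enum B ∣B∣ j ≡ b) → x a ≢ x b
  span x sep (i , refl) (j , refl) = zigzag {x (enum A ∣A∣ i)} (leftTip i) (rightTip zero) (rightTip j)
    where
    sep′ : ∀ z → x (proj₁ (pair′ z)) ≢ x (proj₂ (pair′ z))
    sep′ z = subst (λ y → x (proj₁ (pair′ y)) ≢ x (proj₂ (pair′ y))) (Fin.splitAt-join α (suc β) z) (sep (join α (suc β) z))
    rightTip : ∀ j → x (enum A ∣A∣ zero) ≢ x (enum B ∣B∣ j)
    rightTip j = sep′ (inj₂ j)
    leftTip : ∀ i → x (enum A ∣A∣ i) ≢ x (enum B ∣B∣ zero)
    leftTip zero    = rightTip zero
    leftTip (suc i) = sep′ (inj₁ i)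

-- From partitions to two-colourings.

module Bipartition {n} (Π : Partition n) (A : Subset n) where
  meets? : ∀ v → Dec (∃ λ a → a ∈ A × Π v ≡ Π a)
  meets? v = Fin.any? λ a → (a ∈? A) ×-dec (Π v Fin.≟ Π a)

  -- Merges all parts that meet `A` into one side and all other parts into the other. No part of an
  -- agreeing partition meets both `A` and `B`, so the demands stay separated.
  colour : Fin n → Bool
  colour v = does (meets? v)

  colour-cong : ∀ {u v} → Π u ≡ Π v → colour u ≡ colour v
  colour-cong {u} {v} eq with meets? u | meets? v
  ... | yes _ | yes _ = refl
  ... | no _  | no _  = refl
  ... | yes (a , a∈A , e) | no ¬m = contradiction (a , a∈A , trans (sym eq) e) ¬m
  ... | no ¬m | yes (a , a∈A , e) = contradiction (a , a∈A , trans eq e) ¬m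

  colour-separates : ∀ {B} → Agrees (K A B) Π → ∀ {a b} → a ∈ A → b ∈ B → colour a ≢ colour b
  colour-separates agrees {a} {b} a∈A b∈B eq
    with () ← trans (sym (dec-true (meets? a) (a , a∈A , refl)))
                (trans eq (dec-false (meets? b) λ (a′ , a′∈A , e) → agrees a′ b (a′∈A , b∈B) (sym e)))

-- The colouring is coarser than `Π`, so its sides form a feasible partition that costs no more.
-- Labels of a partition are vertices, so two distinct vertices `p` and `q` must name the sides.
mincut≤cut-of-colouring : ∀ {n} {G : WGraph n} {A B : Subset n} {m} → IsMinCut G (K A B) m → (Π : Partition n) →
  (x : Fin n → Bool) → (∀ {u v} → Π u ≡ Π v → x u ≡ x v) → (∀ {a b} → a ∈ A → b ∈ B → x a ≢ x b) →
  {p q : Fin n} → p ≢ q → m ℚ.≤ cut G Π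
mincut≤cut-of-colouring {n} {G} (_ , lb) Π x x-cong sep {p} {q} p≢q =
  ℚ.≤-trans (lb Π′ λ u v (a , b) e → sep a b (label-injective e)) (cut-coarser G λ u v e → cong label (x-cong e))
  where
  label : Bool → Fin n
  label b = if b then p else q
  label-injective : ∀ {b c} → label b ≡ label c → b ≡ c
  label-injective {false} {false} e = refl
  label-injective {false} {true}  e = contradiction (sym e) p≢q
  label-injective {true}  {false} e = contradiction e p≢q
  label-injective {true}  {true}  e = refl
  Π′ : Partition n
  Π′ = label ∘ x

-- The upper bound on the number of values.

lookup-injective : ∀ {X : Set} {xs : List X} → Unique xs → Injective _≡_ _≡_ (List.lookup xs)
lookup-injective (_ ∷ _)   {zero}  {zero}  _  = refl
lookup-injective (p ∷ _)   {zero}  {suc j} eq = contradiction eq (All.lookup p (∈-lookup j))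
lookup-injective (p ∷ _)   {suc i} {zero}  eq = contradiction (sym eq) (All.lookup p (∈-lookup i))
lookup-injective (_ ∷ uxs) {suc i} {suc j} eq = cong suc (lookup-injective uxs eq)

values-upper-bound : ∀ α β {n} (G : WGraph n) k → HasSize (Values G (suc α) (suc β)) k → k ≤ n ^ (α + suc β)
values-upper-bound α β {n} G k (ms , unique , refl , complete) =
  -- Indices are compared by their values; a strict order on a finite set is well-founded.
  unitriangular⇒size≤rank (spo-wellFounded (On.isStrictPartialOrder value ℚ.<-isStrictPartialOrder)) M diagonal triangular rank
  where
  value : Fin (length ms) → ℚ
  value = List.lookup ms

  witness : ∀ i → Values G (suc α) (suc β) (value i)
  witness i = Equivalence.from (complete (value i)) (∈-lookup i)

  A B : Fin (length ms) → Subset n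
  A i = proj₁ (proj₁ (witness i))
  B i = proj₂ (proj₁ (witness i))

  disjoint : ∀ i → Disjoint (A i) (B i)
  disjoint i = proj₁ (proj₁ (proj₂ (witness i)))

  mincut : ∀ i → IsMinCut G (K (A i) (B i)) (value i)
  mincut i = proj₂ (proj₂ (witness i))

  Π : Fin (length ms) → Partition n
  Π i = proj₁ (proj₁ (mincut i))

  tree : ∀ i → SpanningDemands (α + suc β) (A i) (B i)
  tree i = let (_ , ∣A∣ , ∣B∣) = proj₁ (proj₂ (witness i)) in double-star α β (A i) (B i) ∣A∣ ∣B∣

  x : Fin (length ms) → Fin n → Bool
  x i = Bipartition.colour (Π i) (A i)

  M : Fin (length ms) → Fin (length ms) → Bool
  M i j = ⋀ λ l → x i (end₁ (tree j) l) xor x i (end₂ (tree j) l)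

  rank : RankAtMost (n ^ (α + suc β)) M
  rank = rank-⋀ (α + suc β) λ l → rank-xor-eval x (λ j → end₁ (tree j) l) (λ j → end₂ (tree j) l)

  diagonal : ∀ i → M i i ≡ true
  diagonal i = ⋀-true⁺ λ l → ≢⇒xor
    (Bipartition.colour-separates (Π i) (A i) (proj₁ (proj₂ (proj₁ (mincut i)))) (end₁-∈ (tree i) l) (end₂-∈ (tree i) l))

  -- If colouring `i` separates the demands of `j`, the minimum for `j` is at most the cut that
  -- realises value `i`; the values being distinct, the inequality is strict.
  triangular : ∀ i j → M i j ≡ true → j ≢ i → value j ℚ.< value i
  triangular i j Mij j≢i = ℚ.≰⇒> λ i≤j → j≢i (lookup-injective unique (ℚ.≤-antisym value≤ i≤j))
    where
    -- The edge between the two centres. Its ends differ by disjointness and serve as the two labels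
    -- below.
    l₀ : Fin (α + suc β)
    l₀ = α ↑ʳ zero
    value≤ : value j ℚ.≤ value i
    value≤ = subst (value j ℚ.≤_) (proj₂ (proj₂ (proj₁ (mincut i))))
      (mincut≤cut-of-colouring {G = G} {A j} {B j} (mincut j) (Π i) (x i) (Bipartition.colour-cong (Π i) (A i))
        (spanning (tree j) (x i) λ l → xor⇒≢ (⋀-true⁻ Mij l))
        {end₁ (tree i) l₀} {end₂ (tree i) l₀}
        λ e → disjoint i _ (end₁-∈ (tree i) l₀) (subst (_∈ B i) (sym e) (end₂-∈ (tree i) l₀)))

-- Counting, and finiteness of the set of values.

size-≥-injection : ∀ {X : Set} {P : X → Set} {k N} → HasSize P k →
  (f : Fin N → X) → (∀ i → P (f i)) → Injective _≡_ _≡_ f → N ≤ k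
size-≥-injection (xs , _ , refl , complete) f Pf f-injective = Fin.injective⇒≤ {f = position} λ {i} {j} eq → f-injective (begin
    f i                             ≡⟨ lookup-index (listed i) ⟩
    List.lookup xs (position i) ≡⟨ cong (List.lookup xs) eq ⟩
    List.lookup xs (position j) ≡⟨ lookup-index (listed j) ⟨
    f j                             ∎)
  where
  open ≡-Reasoning
  listed : ∀ i → f i ∈ₗ xs
  listed i = Equivalence.to (complete (f i)) (Pf i)
  position : Fin _ → Fin (length xs)
  position i = index (listed i)

cut-cong : ∀ {n} (G : WGraph n) {Π Π′ : Partition n} → Π ≗ Π′ → cut G Π ≡ cut G Π′
cut-cong G eq = ℚ.≤-antisym
  (cut-coarser G λ u v e → trans (eq u) (trans e (sym (eq v))))
  (cut-coarser G λ u v e → trans (sym (eq u)) (trans e (eq v)))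

Agrees-cong : ∀ {n} {D : DemandGraph n} {Π Π′ : Partition n} → Π ≗ Π′ → Agrees D Π → Agrees D Π′
Agrees-cong eq agrees u v d e = agrees u v d (trans (eq u) (trans e (sym (eq v))))

partition : ∀ {n} → Fin (n ^ n) → Partition n
partition = finToFun

index-of : ∀ {n} → Partition n → Fin (n ^ n)
index-of = funToFin

partition-index-of : ∀ {n} (Π : Partition n) → partition (index-of Π) ≗ Π
partition-index-of = Fin.finToFun-funToFin

instance? : ∀ {n} α β → Decidable (Instance {n} α β)
instance? α β (A , B) = (Fin.all? λ x → (x ∈? A) →-dec ¬? (x ∈? B)) ×-dec (∣ A ∣ ℕ.≟ α) ×-dec (∣ B ∣ ℕ.≟ β)

module _ {n} (G : WGraph n) where

  -- `Fin (n ^ n)` enumerates the partitions up to pointwise equality, which both `cut` and `Agrees`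
  -- respect, so the two quantifiers over partitions become finite searches.
  isMinCut? : ∀ {D} → (∀ u v → Dec (D u v)) → ∀ m → Dec (IsMinCut G D m)
  isMinCut? {D} D? m = map′
    (λ ((c , agrees , eq) , lb) → (partition c , agrees , eq) , λ Π agreesΠ →
      subst (m ℚ.≤_) (cut-cong G (partition-index-of Π)) (lb (index-of Π) (Agrees-cong {D = D} (sym ∘ partition-index-of Π) agreesΠ)))
    (λ ((Π , agrees , eq) , lb) →
      (index-of Π , Agrees-cong {D = D} (sym ∘ partition-index-of Π) agrees , trans (cut-cong G (partition-index-of Π)) eq) , lb ∘ partition)
    (Fin.any? (λ c → agrees? (partition c) ×-dec (cut G (partition c) ℚ.≟ m))
      ×-dec Fin.all? (λ c → agrees? (partition c) →-dec (m ℚ.≤? cut G (partition c))))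
    where
    agrees? : ∀ Π → Dec (Agrees D Π)
    agrees? Π = Fin.all? λ u → Fin.all? λ v → D? u v →-dec ¬? (Π u Fin.≟ Π v)

  values? : ∀ α β → Decidable (Values G α β)
  values? α β m = map′ (λ (A , B , p) → (A , B) , p) (λ ((A , B) , p) → A , B , p)
    (anySubset? λ A → anySubset? λ B → instance? α β (A , B) ×-dec isMinCut? (λ u v → (u ∈? A) ×-dec (v ∈? B)) m)

  -- Every value is the cut of some partition, so filtering the finite list of all cuts lists the
  -- values. Tightness needs this: the broom only bounds their number from below, whereas an exact
  -- count must be supplied.
  values-finite : ∀ α β → ∃ (HasSize (Values G α β))
  values-finite α β = length values , values , deduplicate-! ℚ._≟_ _ , refl , λ m → mk⇔
    (λ { v@(_ , _ , (Π , _ , refl) , _) → ∈-deduplicate⁺ ℚ._≟_ (∈-filter⁺ (values? α β) (cut-listed Π) v) })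
    (proj₂ ∘ ∈-filter⁻ (values? α β) {xs = cuts} ∘ ∈-deduplicate⁻ ℚ._≟_ _)
    where
    cuts values : List ℚ
    cuts = map (cut G ∘ partition) (allFin (n ^ n))
    values = deduplicate ℚ._≟_ (filter (values? α β) cuts)
    cut-listed : ∀ Π → cut G Π ∈ₗ cuts
    cut-listed Π = subst (_∈ₗ cuts) (cut-cong G (partition-index-of Π)) (∈-map⁺ (cut G ∘ partition) (∈-allFin (index-of Π)))

-- Transversals of blocks and the number of instances.

∣++∣ : ∀ {m n} (A : Subset m) (B : Subset n) → ∣ A ++ B ∣ ≡ ∣ A ∣ + ∣ B ∣
∣++∣ []            B = refl
∣++∣ (outside ∷ A) B = ∣++∣ A B
∣++∣ (inside  ∷ A) B = cong suc (∣++∣ A B)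

trues : ∀ {s} → (Fin s → Bool) → ℕ
trues {zero}  c = 0
trues {suc s} c = (if c zero then 1 else 0) + trues (c ∘ suc)

-- The first s * q vertices form s blocks of size q.
module Blocks (s q r : ℕ) where

  n : ℕ
  n = s * q + r

  vertex : Fin s → Fin q → Fin n
  vertex i x = combine i x ↑ˡ r

  locate : Fin n → (Fin s × Fin q) ⊎ Fin r
  locate v with splitAt (s * q) v
  ... | inj₁ u = inj₁ (remQuot q u)
  ... | inj₂ y = inj₂ y

  locate-vertex : ∀ i x → locate (vertex i x) ≡ inj₁ (i , x)
  locate-vertex i x rewrite Fin.splitAt-↑ˡ (s * q) (combine i x) r = cong inj₁ (Fin.remQuot-combine i x)

  locate-rest : ∀ y → locate (s * q ↑ʳ y) ≡ inj₂ y
  locate-rest y rewrite Fin.splitAt-↑ʳ (s * q) r y = refl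

  data Position : Fin n → Set where
    block : ∀ i x → Position (vertex i x)
    rest  : ∀ y → Position (s * q ↑ʳ y)

  position : ∀ v → Position v
  position v with splitAt (s * q) v in eq
  ... | inj₁ u = subst Position
    (trans (cong (_↑ˡ r) (Fin.combine-remQuot {s} q u)) (Fin.splitAt⁻¹-↑ˡ eq))
    (uncurry block (remQuot q u))
  ... | inj₂ y = subst Position (Fin.splitAt⁻¹-↑ʳ eq) (rest y)

  vertex-injective : ∀ {i j x y} → vertex i x ≡ vertex j y → i ≡ j × x ≡ y
  vertex-injective {i} {j} {x} {y} eq = Fin.combine-injective i x j y (Fin.↑ˡ-injective r _ _ eq)

  -- `c` tells which blocks contribute and `g` which vertex of each. Using `c` and its complement
  -- with the same `g` produces both sides of an instance.
  selection : (Fin s → Bool) → (Fin s → Fin q) → Fin s → Subset q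
  selection c g i = if c i then ⁅ g i ⁆ else ⊥

  transversal : (Fin s → Bool) → (Fin s → Fin q) → Subset n
  transversal c g = concat (tabulate (selection c g)) ++ ⊥

  lookup-transversal : ∀ c g i x → lookup (transversal c g) (vertex i x) ≡ lookup (selection c g i) x
  lookup-transversal c g i x = begin
    lookup (transversal c g) (vertex i x)                       ≡⟨ lookup-++ˡ (concat (tabulate (selection c g))) ⊥ (combine i x) ⟩
    lookup (concat (tabulate (selection c g))) (combine i x)    ≡⟨ lookup-concat (tabulate (selection c g)) i x ⟩
    lookup (lookup (tabulate (selection c g)) i) x              ≡⟨ cong (λ S → lookup S x) (lookup∘tabulate (selection c g) i) ⟩
    lookup (selection c g i) x                                  ∎
    where open ≡-Reasoning

  ∈-transversal⁺ : ∀ {c g} i → c i ≡ true → vertex i (g i) ∈ transversal c g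
  ∈-transversal⁺ {c} {g} i ci = lookup⇒[]= _ _ (trans (lookup-transversal c g i (g i)) chosen)
    where
    chosen : lookup (selection c g i) (g i) ≡ inside
    chosen rewrite ci = []=⇒lookup (x∈⁅x⁆ (g i))

  ∈-transversal⁻ : ∀ {c g v} → v ∈ transversal c g → ∃ λ i → c i ≡ true × v ≡ vertex i (g i)
  ∈-transversal⁻ {c} {g} {v} v∈ with position v
  ... | rest y = contradiction (lookup⇒[]= y ⊥ (trans (sym (lookup-++ʳ (concat (tabulate (selection c g))) ⊥ y)) ([]=⇒lookup v∈))) ∉⊥
  ... | block i x = i , chosen (lookup⇒[]= x _ (trans (sym (lookup-transversal c g i x)) ([]=⇒lookup v∈)))
    where
    chosen : x ∈ selection c g i → c i ≡ true × vertex i x ≡ vertex i (g i)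
    chosen x∈ with c i
    ... | true  = refl , cong (vertex i) (x∈⁅y⁆⇒x≡y (g i) x∈)
    ... | false = contradiction x∈ ∉⊥

  ∣transversal∣ : ∀ c g → ∣ transversal c g ∣ ≡ trues c
  ∣transversal∣ c g = begin
    ∣ transversal c g ∣                                ≡⟨ ∣++∣ (concat (tabulate (selection c g))) ⊥ ⟩
    ∣ concat (tabulate (selection c g)) ∣ + ∣ ⊥ {r} ∣   ≡⟨ cong₂ _+_ (go c g) (∣⊥∣≡0 r) ⟩
    trues c + 0                                        ≡⟨ ℕ.+-identityʳ _ ⟩
    trues c                                            ∎
    where
    open ≡-Reasoning
    ∣selection∣ : ∀ b (x : Fin q) → ∣ (if b then ⁅ x ⁆ else ⊥) ∣ ≡ (if b then 1 else 0)
    ∣selection∣ true  x = ∣⁅x⁆∣≡1 x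
    ∣selection∣ false x = ∣⊥∣≡0 q
    go : ∀ {t} (c : Fin t → Bool) (g : Fin t → Fin q) →
      ∣ concat (tabulate λ i → if c i then ⁅ g i ⁆ else ⊥) ∣ ≡ trues c
    go {zero}  c g = refl
    go {suc t} c g = trans (∣++∣ (if c zero then ⁅ g zero ⁆ else ⊥) _)
      (cong₂ _+_ (∣selection∣ (c zero) (g zero)) (go (c ∘ suc) (g ∘ suc)))

  transversal-disjoint : ∀ c g → Disjoint (transversal c g) (transversal (not ∘ c) g)
  transversal-disjoint c g v v∈A v∈B with ∈-transversal⁻ {c} v∈A | ∈-transversal⁻ {not ∘ c} v∈B
  ... | i , ci , refl | j , ¬cj , eq with refl ← proj₁ (vertex-injective {i} {j} eq)
    with () ← trans (sym ¬cj) (cong not ci)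

  transversal-injective : ∀ {c g g′} → transversal c g ≡ transversal c g′ → ∀ i → c i ≡ true → g i ≡ g′ i
  transversal-injective {c} {g} {g′} eq i ci
    with j , _ , v≡ ← ∈-transversal⁻ {c} {g′} (subst (vertex i (g i) ∈_) eq (∈-transversal⁺ {c} {g} i ci))
    with refl ← proj₁ (vertex-injective {i} {j} v≡) = proj₂ (vertex-injective {i} {j} v≡)

leafColour : ∀ α β → Fin (α + β) → Bool
leafColour zero    β i       = false
leafColour (suc α) β zero    = true
leafColour (suc α) β (suc i) = leafColour α β i

-- The colour true marks the blocks that meet A.  In the broom, block 0 holds the root and block 1 the path.
colour : ∀ α β → Fin (2 + (α + β)) → Bool
colour α β zero          = true
colour α β (suc zero)    = false
colour α β (suc (suc i)) = leafColour α β i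

trues-leafColour : ∀ α β → trues (leafColour α β) ≡ α
trues-leafColour zero    zero    = refl
trues-leafColour zero    (suc β) = trues-leafColour zero β
trues-leafColour (suc α) β       = cong suc (trues-leafColour α β)

trues-not-leafColour : ∀ α β → trues (not ∘ leafColour α β) ≡ β
trues-not-leafColour zero    zero    = refl
trues-not-leafColour zero    (suc β) = cong suc (trues-not-leafColour zero β)
trues-not-leafColour (suc α) β       = trues-not-leafColour α β

module Transversals (α β q r : ℕ) where
  open Blocks (2 + (α + β)) q r public

  pair : (Fin (2 + (α + β)) → Fin q) → Subset n × Subset n
  pair g = transversal (colour α β) g , transversal (not ∘ colour α β) g

  pair-instance : ∀ g → Instance (suc α) (suc β) (pair g)
  pair-instance g = transversal-disjoint (colour α β) g
    , trans (∣transversal∣ (colour α β) g) (cong suc (trues-leafColour α β))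
    , trans (∣transversal∣ (not ∘ colour α β) g) (cong suc (trues-not-leafColour α β))

  -- The colour of a block decides which of the two sets contains its chosen vertex, so the pair
  -- determines every choice.
  pair-injective : ∀ {g g′} → pair g ≡ pair g′ → g ≗ g′
  pair-injective {g} {g′} eq i with colour α β i in ci
  ... | true  = transversal-injective {colour α β} {g} {g′} (cong proj₁ eq) i ci
  ... | false = transversal-injective {not ∘ colour α β} {g} {g′} (cong proj₂ eq) i (cong not ci)

  instances-lower-bound : ∀ {k} → HasSize (Instance {n} (suc α) (suc β)) k → q ^ (2 + (α + β)) ≤ k
  instances-lower-bound size = size-≥-injection size (pair ∘ finToFun) (pair-instance ∘ finToFun)
    (λ eq → finToFun-injective {q} {2 + (α + β)} (pair-injective eq))

-- Binary values as rational numbers.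

ι : ℕ → ℚ
ι zero    = 0ℚ
ι (suc k) = 1ℚ ℚ.+ ι k

ι-+ : ∀ a b → ι (a + b) ≡ ι a ℚ.+ ι b
ι-+ zero    b = sym (ℚ.+-identityˡ (ι b))
ι-+ (suc a) b = trans (cong (1ℚ ℚ.+_) (ι-+ a b)) (sym (ℚ.+-assoc 1ℚ (ι a) (ι b)))

ι-nonneg : ∀ k → 0ℚ ℚ.≤ ι k
ι-nonneg zero    = ℚ.≤-refl
ι-nonneg (suc k) = ℚ.+-mono-≤ (ℚ.nonNegative⁻¹ 1ℚ) (ι-nonneg k)

ι-mono-≤ : ∀ {a b} → a ≤ b → ι a ℚ.≤ ι b
ι-mono-≤ {b = b} z≤n       = ι-nonneg b
ι-mono-≤         (s≤s a≤b) = ℚ.+-monoʳ-≤ 1ℚ (ι-mono-≤ a≤b)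

0<ι-suc : ∀ k → 0ℚ ℚ.< ι (suc k)
0<ι-suc k = ℚ.+-mono-<-≤ (ℚ.positive⁻¹ 1ℚ) (ι-nonneg k)

ι-mono-< : ∀ {a b} → a < b → ι a ℚ.< ι b
ι-mono-< {zero}  {suc b} _         = 0<ι-suc b
ι-mono-< {suc a} {suc b} (s≤s a<b) = ℚ.+-monoʳ-< 1ℚ (ι-mono-< a<b)

ι-injective : ∀ {a b} → ι a ≡ ι b → a ≡ b
ι-injective {a} {b} eq = ℕ.≤-antisym
  (ℕ.≮⇒≥ λ b<a → ℚ.<⇒≢ (ι-mono-< b<a) (sym eq)) (ℕ.≮⇒≥ λ a<b → ℚ.<⇒≢ (ι-mono-< a<b) eq)

module Sumℕ = CommutativeMonoidSum ℕ.+-0-commutativeMonoid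
open Sumℕ using (sum)

sumFin-ι : ∀ {n} (f : Fin n → ℕ) → sumFin (ι ∘ f) ≡ ι (sum f)
sumFin-ι {zero}  f = refl
sumFin-ι {suc n} f = trans (cong (ι (f zero) ℚ.+_) (sumFin-ι (f ∘ suc))) (sym (ι-+ (f zero) _))

wt : ∀ {n} → Fin n → ℕ
wt {suc n} zero    = 2 ^ n
wt {suc n} (suc v) = wt v

-- The number whose binary digits, most significant first, are given by `f`.
value : ∀ {n} → (Fin n → Bool) → ℕ
value f = sum λ v → if f v then wt v else 0

value<2^n : ∀ {n} (f : Fin n → Bool) → value f < 2 ^ n
value<2^n {zero}  f = s≤s z≤n
value<2^n {suc n} f with f zero
... | true  = ℕ.+-mono-≤-< (ℕ.≤-refl {2 ^ n}) (subst (value (f ∘ suc) <_) (sym (ℕ.+-identityʳ _)) (value<2^n (f ∘ suc)))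
... | false = ℕ.<-≤-trans (value<2^n (f ∘ suc)) (ℕ.m≤m+n (2 ^ n) _)

-- Lexicographic comparison. At the first place where the digits differ, `f` cannot have the 1: the
-- hypothesis would then give an even earlier difference.
value-lex : ∀ {n} {f g : Fin n → Bool} →
  (∀ t → f t ≡ true → g t ≡ true ⊎ ∃ λ i → i Fin.< t × g i ≡ true × f i ≡ false) → value f ≤ value g
value-lex {zero}  h = z≤n
value-lex {suc n} {f} {g} h with f zero in f₀ | g zero in g₀
... | false | true  = ℕ.≤-trans (ℕ.<⇒≤ (value<2^n (f ∘ suc))) (ℕ.m≤m+n (2 ^ n) _)
... | true  | false with h zero f₀
...   | inj₁ e = contradiction (trans (sym g₀) e) λ ()
...   | inj₂ (_ , () , _)
value-lex {suc n} {f} {g} h | true | true = ℕ.+-monoʳ-≤ (2 ^ n) (value-lex h′)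
  where
  h′ : ∀ t → f (suc t) ≡ true → g (suc t) ≡ true ⊎ ∃ λ i → i Fin.< t × g (suc i) ≡ true × f (suc i) ≡ false
  h′ t ft with h (suc t) ft
  ... | inj₁ e = inj₁ e
  ... | inj₂ (zero , _ , _ , e) = contradiction (trans (sym f₀) e) λ ()
  ... | inj₂ (suc i , s≤s i<t , gi , fi) = inj₂ (i , i<t , gi , fi)
value-lex {suc n} {f} {g} h | false | false = value-lex h′
  where
  h′ : ∀ t → f (suc t) ≡ true → g (suc t) ≡ true ⊎ ∃ λ i → i Fin.< t × g (suc i) ≡ true × f (suc i) ≡ false
  h′ t ft with h (suc t) ft
  ... | inj₁ e = inj₁ e
  ... | inj₂ (zero , _ , e , _) = contradiction (trans (sym g₀) e) λ ()
  ... | inj₂ (suc i , s≤s i<t , gi , fi) = inj₂ (i , i<t , gi , fi)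

value-injective : ∀ {n} {f g : Fin n → Bool} → value f ≡ value g → f ≗ g
value-injective {suc n} {f} {g} eq v with f zero in f₀ | g zero in g₀
value-injective {suc n} {f} {g} eq zero    | true  | true  = trans f₀ (sym g₀)
value-injective {suc n} {f} {g} eq (suc v) | true  | true  = value-injective (ℕ.+-cancelˡ-≡ (2 ^ n) _ _ eq) v
value-injective {suc n} {f} {g} eq zero    | false | false = trans f₀ (sym g₀)
value-injective {suc n} {f} {g} eq (suc v) | false | false = value-injective eq v
value-injective {suc n} {f} {g} eq v       | true  | false =
  contradiction (subst (_< 2 ^ n) (sym eq) (value<2^n (g ∘ suc))) (ℕ.m+n≮m (2 ^ n) _)
value-injective {suc n} {f} {g} eq v       | false | true  =
  contradiction (subst (_< 2 ^ n) eq (value<2^n (f ∘ suc))) (ℕ.m+n≮m (2 ^ n) _)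

-- Cuts of weighted forests.

sum-δ : ∀ {n} (u : Fin n) x → sum (λ v → if does (u Fin.≟ v) then x else 0) ≡ x
sum-δ {suc n} zero    x = trans (cong (x +_) (Sumℕ.sum-replicate-zero n)) (ℕ.+-identityʳ x)
sum-δ {suc n} (suc u) x = sum-δ u x

-- The vertex v is joined to parent v by an edge of weight wt v; fixed points of parent are roots.
module Forest {n} (parent : Fin n → Fin n) (parent≤ : ∀ v → parent v Fin.≤ v) where

  -- The test `u < v` discards the loops at the roots and, by `parent≤`, no other edge.
  edge : Fin n → Fin n → ℕ
  edge u v = if does (u Fin.<? v) ∧ does (parent v Fin.≟ u) then wt v else 0

  forest : WGraph n
  forest = record
    { w = λ u v → ι (edge u v + edge v u)
    ; w-sym = λ u v → cong ι (ℕ.+-comm (edge u v) (edge v u))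
    ; w-nonneg = λ u v → ι-nonneg (edge u v + edge v u)
    }

  cuts : Partition n → Fin n → Bool
  cuts Π v = not (does (Π (parent v) Fin.≟ Π v))

  -- Each edge is charged to its child: after exchanging the sums, the inner sum over `u` only sees
  -- `parent v`.
  cut-forest : ∀ Π → cut forest Π ≡ ι (value (cuts Π))
  cut-forest Π = begin
    cut forest Π                                  ≡⟨ sumFin-cong (λ u → sumFin-cong (term u)) ⟩
    sumFin (λ u → sumFin λ v → ι (contribution u v)) ≡⟨ sumFin-cong (λ u → sumFin-ι (contribution u)) ⟩
    sumFin (λ u → ι (sum (contribution u)))       ≡⟨ sumFin-ι (λ u → sum (contribution u)) ⟩
    ι (sum λ u → sum (contribution u))            ≡⟨ cong ι (Sumℕ.∑-comm contribution) ⟩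
    ι (sum λ v → sum λ u → contribution u v)      ≡⟨ cong ι (Sumℕ.sum-cong-≗ {n} λ v → sum-δ (parent v) _) ⟩
    ι (value (cuts Π))                            ∎
    where
    open ≡-Reasoning
    contribution : Fin n → Fin n → ℕ
    contribution u v = if does (parent v Fin.≟ u) then (if cuts Π v then wt v else 0) else 0
    term : ∀ u v → (if does (u Fin.<? v) ∧ not (does (Π u Fin.≟ Π v)) then ι (edge u v + edge v u) else 0ℚ)
             ≡ ι (contribution u v)
    term u v with u Fin.<? v
    term u v | yes u<v rewrite dec-true (u Fin.<? v) u<v | dec-false (v Fin.<? u) (ℕ.<-asym u<v) with parent v Fin.≟ u
    term u v | yes u<v | no _ with does (Π u Fin.≟ Π v)
    ... | true  = refl
    ... | false = refl
    term u v | yes u<v | yes refl with does (Π u Fin.≟ Π v)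
    ... | true  = refl
    ... | false = cong ι (ℕ.+-identityʳ (wt v))
    term u v | no u≮v rewrite dec-false (u Fin.<? v) u≮v with parent v Fin.≟ u
    ... | no _ = refl
    -- Here `v` is its own parent, so it lies in the same part as its parent and contributes
    -- nothing.
    ... | yes refl
      rewrite dec-true (Π (parent v) Fin.≟ Π v) (cong Π (Fin.toℕ-injective (ℕ.≤-antisym (parent≤ v) (ℕ.≮⇒≥ u≮v)))) = refl

-- The broom and its minimum cuts.

-- If the labels of two positions on a path differ, they already differ across one step between
-- them. This finds a cut edge on a given stretch of the broom's path.
walk : ∀ {q n} (h : Fin (suc q) → Fin n) i j → i Fin.≤ j → h i ≢ h j →
  ∃ λ x → i Fin.≤ inject₁ x × suc x Fin.≤ j × h (inject₁ x) ≢ h (suc x)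
walk h zero zero _ ne = contradiction refl ne
walk {suc q} h zero (suc j) _ ne with h zero Fin.≟ h (suc zero)
... | no ne₀ = zero , z≤n , s≤s z≤n , ne₀
... | yes e₀ with x , _ , x≤j , neₓ ← walk (h ∘ suc) zero j z≤n (λ e → ne (trans e₀ e)) = suc x , z≤n , s≤s x≤j , neₓ
walk {suc q} h (suc i) (suc j) (s≤s i≤j) ne
  with x , i≤x , x≤j , neₓ ← walk (h ∘ suc) i j i≤j ne = suc x , s≤s i≤x , s≤s x≤j , neₓ

module Broom (α β q′ r : ℕ) where
  q : ℕ
  q = suc q′
  open Transversals α β q r

  root : Fin n
  root = vertex zero zero

  path : Fin (suc q) → Fin n
  path zero    = root
  path (suc x) = vertex (suc zero) x

  tail : Fin n
  tail = path (fromℕ q)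

  -- Leaves for `A` hang at the tail and leaves for `B` at the root, each at the end that a minimum
  -- cut puts on the opposite side. The rest of block 0 and the `r` spare vertices hang from the
  -- root and are never terminals.
  parentAt : (Fin (2 + (α + β)) × Fin q) ⊎ Fin r → Fin n
  parentAt (inj₁ (zero , _))        = root
  parentAt (inj₁ (suc zero , x))    = path (inject₁ x)
  parentAt (inj₁ (suc (suc i) , _)) = if leafColour α β i then tail else root
  parentAt (inj₂ _)                 = root

  parent : Fin n → Fin n
  parent = parentAt ∘ locate

  vertex-mono : ∀ {i j} x y → i Fin.< j → vertex i x Fin.< vertex j y
  vertex-mono {i} {j} x y i<j
    rewrite Fin.toℕ-↑ˡ (combine i x) r | Fin.toℕ-↑ˡ (combine j y) r = Fin.combine-monoˡ-< x y i<j

  vertex-monoʳ : ∀ i {x y : Fin q} → x Fin.< y → vertex i x Fin.< vertex i y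
  vertex-monoʳ i {x} {y} x<y
    rewrite Fin.toℕ-↑ˡ (combine i x) r | Fin.toℕ-↑ˡ (combine i y) r | Fin.toℕ-combine i x | Fin.toℕ-combine i y
    = ℕ.+-monoʳ-< (q * toℕ i) x<y

  parent≤ : ∀ v → parent v Fin.≤ v
  parent≤ v with position v
  ... | rest y rewrite locate-rest y = z≤n
  ... | block i x rewrite locate-vertex i x = go i x
    where
    go : ∀ i x → parentAt (inj₁ (i , x)) Fin.≤ vertex i x
    -- The root is the vertex with number 0.
    go zero x = z≤n
    go (suc zero) zero = z≤n
    go (suc zero) (suc x) = ℕ.<⇒≤ (vertex-monoʳ (suc zero) (s≤s (ℕ.≤-reflexive (Fin.toℕ-inject₁ x))))
    go (suc (suc i)) x with leafColour α β i
    ... | true  = ℕ.<⇒≤ (vertex-mono (fromℕ q′) x (s≤s (s≤s z≤n)))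
    ... | false = z≤n

  open Forest parent parent≤

  module Terminals (g : Fin (suc (α + β)) → Fin q) where
    choice : Fin (2 + (α + β)) → Fin q
    choice zero    = zero
    choice (suc i) = g i

    A B : Subset n
    A = proj₁ (pair choice)
    B = proj₂ (pair choice)

    -- Marks the terminals other than the root, that is, the children of the edges in the intended
    -- minimum cut.
    tipAt : (Fin (2 + (α + β)) × Fin q) ⊎ Fin r → Bool
    tipAt (inj₁ (zero , _))  = false
    tipAt (inj₁ (suc i , x)) = does (x Fin.≟ g i)
    tipAt (inj₂ _)           = false

    tip : Fin n → Bool
    tip = tipAt ∘ locate

    root∈A : root ∈ A
    root∈A = ∈-transversal⁺ {colour α β} {choice} zero refl

    hook : Fin n
    hook = vertex (suc zero) (g zero)

    hook∈B : hook ∈ B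
    hook∈B = ∈-transversal⁺ {not ∘ colour α β} {choice} (suc zero) refl

    cuts-vertex : ∀ Π i x → Π (parentAt (inj₁ (i , x))) ≢ Π (vertex i x) → cuts Π (vertex i x) ≡ true
    cuts-vertex Π i x ne rewrite locate-vertex i x = cong not (dec-false (Π (parentAt (inj₁ (i , x))) Fin.≟ Π (vertex i x)) ne)

    off-hook : ∀ x → x ≢ g zero → tip (vertex (suc zero) x) ≡ false
    off-hook x ne rewrite locate-vertex (suc zero) x = dec-false (x Fin.≟ g zero) ne

    module _ (Π : Partition n) (agrees : Agrees (K A B) Π) where
      -- The alternative that `value-lex` requires at `t` in order to compare `tip` with `cuts Π`.
      Dominated : Fin n → Set
      Dominated t = cuts Π t ≡ true ⊎ ∃ λ i → i Fin.< t × cuts Π i ≡ true × tip i ≡ false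

      -- A cut edge on the path above the hook outweighs all edges above terminals together.
      hook-dominated : Dominated hook
      -- Position `suc x` of `path` is vertex `x` of block 1, so the step found is the edge above
      -- that vertex.
      hook-dominated with walk (Π ∘ path) zero (suc (g zero)) z≤n (agrees root hook (root∈A , hook∈B))
      ... | x , _ , s≤s x≤g , ne with x Fin.≟ g zero
      ...   | yes refl = inj₁ (cuts-vertex Π (suc zero) x ne)
      ...   | no x≢g = inj₂ (vertex (suc zero) x , vertex-monoʳ (suc zero) (Fin.≤∧≢⇒< x≤g x≢g)
                            , cuts-vertex Π (suc zero) x ne , off-hook x x≢g)

      -- A far leaf on the side of the tail forces a cut edge between hook and tail, heavier than all leaf edges together.
      leaf-dominated : ∀ i → Dominated (vertex (suc (suc i)) (g (suc i)))
      leaf-dominated i with leafColour α β i in leaf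
      -- A near leaf lies in `B` and its parent, the root, in `A`: its edge joins a demand pair.
      ... | false = inj₁ (cuts-vertex Π (suc (suc i)) (g (suc i)) separated)
        where
        separated : Π (if leafColour α β i then tail else root) ≢ Π (vertex (suc (suc i)) (g (suc i)))
        separated rewrite leaf = agrees root _ (root∈A , ∈-transversal⁺ {not ∘ colour α β} {choice} (suc (suc i)) (cong not leaf))
      ... | true with Π tail Fin.≟ Π (vertex (suc (suc i)) (g (suc i)))
      ...   | no ne = inj₁ (cuts-vertex Π (suc (suc i)) (g (suc i)) separated)
        where
        separated : Π (if leafColour α β i then tail else root) ≢ Π (vertex (suc (suc i)) (g (suc i)))
        separated rewrite leaf = ne
      ...   | yes e with walk (Π ∘ path) (suc (g zero)) (fromℕ q) (s≤s (Fin.≤fromℕ (g zero)))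
                      (λ e′ → agrees _ hook (∈-transversal⁺ {colour α β} {choice} (suc (suc i)) leaf , hook∈B) (sym (trans e′ e)))
      ...     | x , g<x , _ , ne = inj₂ (vertex (suc zero) x , vertex-mono x (g (suc i)) (s≤s (s≤s z≤n))
                                    , cuts-vertex Π (suc zero) x ne
                                    , off-hook x λ x≡g → ℕ.<-irrefl (cong toℕ (sym x≡g)) (ℕ.≤-trans g<x (ℕ.≤-reflexive (Fin.toℕ-inject₁ x))))

      tip-dominated : ∀ t → tip t ≡ true → Dominated t
      tip-dominated t tt with position t
      ... | rest y = contradiction (trans (sym tt) (cong tipAt (locate-rest y))) λ ()
      ... | block i x = go i x (trans (sym (cong tipAt (locate-vertex i x))) tt)
        where
        go : ∀ i x → tipAt (inj₁ (i , x)) ≡ true → Dominated (vertex i x)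
        go (suc i) x tt with x Fin.≟ g i
        go (suc zero)    x tt | yes refl = hook-dominated
        go (suc (suc i)) x tt | yes refl = leaf-dominated i
        go (suc i)       x () | no _

      tip-value≤cut : ι (value tip) ℚ.≤ cut forest Π
      tip-value≤cut = subst (ι (value tip) ℚ.≤_) (sym (cut-forest Π)) (ι-mono-≤ (value-lex tip-dominated))

    -- The sides of a minimum cut; true is the side of B.
    sideAt : (Fin (2 + (α + β)) × Fin q) ⊎ Fin r → Bool
    sideAt (inj₁ (zero , _))        = false
    sideAt (inj₁ (suc zero , x))    = does (g zero Fin.≤? x)
    -- An unchosen leaf stays on the side of its parent, true at the tail and false at the root; a
    -- chosen one is flipped.
    sideAt (inj₁ (suc (suc i) , x)) = leafColour α β i xor does (x Fin.≟ g (suc i))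
    sideAt (inj₂ _)                 = false

    side : Fin n → Bool
    side = sideAt ∘ locate

    optimum : Partition n
    optimum v = if side v then hook else root

    optimum-injective : ∀ {u v} → optimum u ≡ optimum v → side u ≡ side v
    optimum-injective {u} {v} eq with side u | side v
    ... | false | false = refl
    ... | true  | true  = refl
    ... | true  | false = contradiction (proj₁ (vertex-injective {suc zero} {zero} eq)) λ ()
    ... | false | true  = contradiction (proj₁ (vertex-injective {zero} {suc zero} eq)) λ ()

    side-A : ∀ {a} → a ∈ A → side a ≡ false
    side-A a∈A with ∈-transversal⁻ {colour α β} {choice} a∈A
    ... | zero , _ , refl rewrite locate-vertex zero (choice zero) = refl
    ... | suc (suc i) , leaf , refl
      rewrite locate-vertex (suc (suc i)) (g (suc i)) | leaf | dec-true (g (suc i) Fin.≟ g (suc i)) refl = refl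

    side-B : ∀ {b} → b ∈ B → side b ≡ true
    side-B b∈B with ∈-transversal⁻ {not ∘ colour α β} {choice} b∈B
    ... | suc zero , _ , refl rewrite locate-vertex (suc zero) (g zero) = dec-true (g zero Fin.≤? g zero) ℕ.≤-refl
    ... | suc (suc i) , leaf , refl
      rewrite locate-vertex (suc (suc i)) (g (suc i)) | dec-true (g (suc i) Fin.≟ g (suc i)) refl
      = trans (Bool.xor-comm (leafColour α β i) true) leaf

    optimum-agrees : Agrees (K A B) optimum
    optimum-agrees u v (u∈A , v∈B) eq
      with () ← trans (sym (side-A u∈A)) (trans (optimum-injective {u} {v} eq) (side-B v∈B))

    cuts⇒side-changes : ∀ v → cuts optimum v ≡ true → side (parent v) xor side v ≡ true
    cuts⇒side-changes v c = ≢⇒xor λ e → contradiction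
      (trans (sym c) (cong not (dec-true (optimum (parent v) Fin.≟ optimum v) (cong (if_then hook else root) e)))) λ ()

    side-tail : side tail ≡ true
    side-tail rewrite locate-vertex (suc zero) (fromℕ q′) = dec-true (g zero Fin.≤? fromℕ q′) (Fin.≤fromℕ (g zero))

    side-root : side root ≡ false
    side-root rewrite locate-vertex zero zero = refl

    side-changes⇒tip : ∀ v → side (parent v) xor side v ≡ true → tip v ≡ true
    side-changes⇒tip v c with position v
    ... | rest y rewrite locate-rest y | side-root = contradiction c λ ()
    ... | block i x rewrite locate-vertex i x = go i x c
      where
      go : ∀ i x → side (parentAt (inj₁ (i , x))) xor sideAt (inj₁ (i , x)) ≡ true → tipAt (inj₁ (i , x)) ≡ true
      go zero x c rewrite side-root = contradiction c λ ()
      go (suc zero) zero c rewrite side-root with g zero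
      ... | zero = refl
      ... | suc _ = contradiction c λ ()
      go (suc zero) (suc x) c rewrite locate-vertex (suc zero) (inject₁ x) with g zero Fin.≤? inject₁ x | g zero Fin.≤? suc x
      ... | yes p | yes p′
        rewrite dec-true (g zero Fin.≤? inject₁ x) p | dec-true (g zero Fin.≤? suc x) p′ = contradiction c λ ()
      ... | no ¬p | no ¬p′
        rewrite dec-false (g zero Fin.≤? inject₁ x) ¬p | dec-false (g zero Fin.≤? suc x) ¬p′ = contradiction c λ ()
      ... | yes p | no ¬p = contradiction (ℕ.≤-trans p (ℕ.≤-trans (ℕ.≤-reflexive (Fin.toℕ-inject₁ x)) (ℕ.n≤1+n _))) ¬p
      -- The side changes across this path edge, so the threshold `g zero` is exactly `suc x`.
      ... | no ¬p | yes p = dec-true (suc x Fin.≟ g zero) (Fin.toℕ-injective (ℕ.≤-antisym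
              (subst (_< toℕ (g zero)) (Fin.toℕ-inject₁ x) (ℕ.≰⇒> ¬p)) p))
      go (suc (suc i)) x c with leafColour α β i
      ... | false rewrite side-root = c
      ... | true  rewrite side-tail = trans (sym (Bool.not-involutive _)) c

    -- Only edges above tips are cut, which gives one inequality; the lower bound for all agreeing
    -- partitions, applied to `optimum`, gives the other.
    optimum-value : cut forest optimum ≡ ι (value tip)
    optimum-value = ℚ.≤-antisym
      (subst (ℚ._≤ ι (value tip)) (sym (cut-forest optimum))
        (ι-mono-≤ (value-lex λ v c → inj₁ (side-changes⇒tip v (cuts⇒side-changes v c)))))
      (tip-value≤cut optimum optimum-agrees)

    tip-value : Values forest (suc α) (suc β) (ι (value tip))
    tip-value = pair choice , pair-instance choice , (optimum , optimum-agrees , optimum-value) , tip-value≤cut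

  tip-injective : ∀ {g g′} → Terminals.tip g ≗ Terminals.tip g′ → g ≗ g′
  tip-injective {g} {g′} eq i with eq (vertex (suc i) (g i))
  ... | e rewrite locate-vertex (suc i) (g i) | dec-true (g i Fin.≟ g i) refl with g i Fin.≟ g′ i
  ...   | yes p = p
  ...   | no _  = contradiction e λ ()

  values-lower-bound : ∀ {k} → HasSize (Values forest (suc α) (suc β)) k → q ^ suc (α + β) ≤ k
  values-lower-bound size = size-≥-injection size (λ c → ι (value (Terminals.tip (finToFun c))))
    (λ c → Terminals.tip-value (finToFun c))
    λ eq → finToFun-injective {q} {suc (α + β)} (tip-injective (value-injective (ι-injective eq)))

-- Block sizes and assembly of the three bounds.

block-decomposition : ∀ s n → suc s ≤ n → ∃ λ q → ∃ λ r → n ≡ suc s * suc q + r × n ≤ 2 * suc s * suc q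
block-decomposition s n s<n = go (n / suc s) (m≡m%n+[m/n]*n n (suc s))
  where
  r = n % suc s
  go : ∀ q → n ≡ r + q * suc s → ∃ λ q → ∃ λ r → n ≡ suc s * suc q + r × n ≤ 2 * suc s * suc q
  -- With quotient 0, `n` would be its own remainder and hence below `suc s`.
  go zero eq = contradiction (subst (_< suc s) (sym (trans eq (ℕ.+-identityʳ r))) (m%n<n n (suc s))) (ℕ.≤⇒≯ s<n)
  go (suc q) eq = q , r , n≡ , (begin
    n                                      ≡⟨ n≡ ⟩
    -- The remainder is smaller than one layer of `suc s` vertices, hence at most the part already
    -- covered; this produces the factor 2.
    suc s * suc q + r                      ≤⟨ ℕ.+-monoʳ-≤ (suc s * suc q) (ℕ.<⇒≤ (m%n<n n (suc s))) ⟩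
    suc s * suc q + suc s                  ≤⟨ ℕ.+-monoʳ-≤ (suc s * suc q) (ℕ.m≤m*n (suc s) (suc q)) ⟩
    suc s * suc q + suc s * suc q          ≡⟨ cong (suc s * suc q +_) (ℕ.+-identityʳ _) ⟨
    2 * (suc s * suc q)                    ≡⟨ ℕ.*-assoc 2 (suc s) (suc q) ⟨
    2 * suc s * suc q                      ∎)
    where
    open ℕ.≤-Reasoning
    n≡ : n ≡ suc s * suc q + r
    n≡ = trans eq (trans (ℕ.+-comm r _) (cong (_+ r) (ℕ.*-comm (suc q) (suc s))))

^-distribʳ-* : ∀ a b e → (a * b) ^ e ≡ a ^ e * b ^ e
^-distribʳ-* a b zero    = refl
^-distribʳ-* a b (suc e) = trans (cong (a * b *_) (^-distribʳ-* a b e)) (ℕ.[m*n]*[o*p]≡[m*o]*[n*p] a b (a ^ e) (b ^ e))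

power-bound : ∀ {n k} c q e → n ≤ c * q → q ^ e ≤ k → n ^ e ≤ c ^ e * k
power-bound {n} {k} c q e n≤cq q^e≤k = begin
  n ^ e          ≤⟨ ℕ.^-monoˡ-≤ e n≤cq ⟩
  (c * q) ^ e    ≡⟨ ^-distribʳ-* c q e ⟩
  c ^ e * q ^ e  ≤⟨ ℕ.*-monoʳ-≤ (c ^ e) q^e≤k ⟩
  c ^ e * k      ∎
  where open ℕ.≤-Reasoning

theorem1p2 : (α β : ℕ) → 1 ≤ α → 1 ≤ β →
    -- upper bound O_{α,β}(n^{α+β-1}) on the number of distinct values
    (Σ ℕ λ C → Σ ℕ λ N → ∀ n → N ≤ n → (G : WGraph n) → ∀ k →
        HasSize (Values G α β) k → k ≤ C * n ^ (α + β ∸ 1))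
    -- redundancy factor Ω_{α,β}(n): #instances / #values ≥ n / C
    × (Σ ℕ λ C → Σ ℕ λ N → ∀ n → N ≤ n → (G : WGraph n) → ∀ k r →
        HasSize (Values G α β) k → HasSize (Instance {n} α β) r →
        n * k ≤ C * r)
    -- existential tightness: Ω_{α,β}(n^{α+β-1}) values for some G on n vertices
    × (Σ ℕ λ C → Σ ℕ λ N → ∀ n → N ≤ n → Σ (WGraph n) λ G → Σ ℕ λ k →
        HasSize (Values G α β) k × n ^ (α + β ∸ 1) ≤ C * k)
theorem1p2 (suc α) (suc β) _ _ = (1 , 0 , upper) , (c ^ s , s , redundancy) , (c ^ suc (α + β) , s , tight)
  where
  -- `s` is the number of blocks, and `n ≥ s` makes them nonempty. By `block-decomposition`, `n` is
  -- at most `c` times the block size, so raising to the powers `s` and `s - 1` gives the constants.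
  s c : ℕ
  s = 2 + (α + β)
  c = 2 * s

  upper : ∀ n → 0 ≤ n → (G : WGraph n) → ∀ k → HasSize (Values G (suc α) (suc β)) k → k ≤ 1 * n ^ (α + suc β)
  upper n _ G k size = subst (k ≤_) (sym (ℕ.*-identityˡ _)) (values-upper-bound α β G k size)

  redundancy : ∀ n → s ≤ n → (G : WGraph n) → ∀ k r → HasSize (Values G (suc α) (suc β)) k →
    HasSize (Instance {n} (suc α) (suc β)) r → n * k ≤ c ^ s * r
  redundancy n s≤n G k r valuesSize instancesSize with block-decomposition (suc (α + β)) n s≤n
  ... | q , rest , refl , n≤cq = ℕ.≤-trans
    -- The values number at most `n ^ (s - 1)`, so the left side is at most `n ^ s`, the order of
    -- the number of instances.
    (ℕ.*-monoʳ-≤ n (subst (λ e → k ≤ n ^ e) (ℕ.+-suc α β) (values-upper-bound α β G k valuesSize)))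
    (power-bound c (suc q) s n≤cq (Transversals.instances-lower-bound α β (suc q) rest instancesSize))

  tight : ∀ n → s ≤ n → Σ (WGraph n) λ G → Σ ℕ λ k →
    HasSize (Values G (suc α) (suc β)) k × n ^ (α + suc β) ≤ c ^ suc (α + β) * k
  tight n s≤n with block-decomposition (suc (α + β)) n s≤n
  ... | q , rest , refl , n≤cq =
    let open Broom α β q rest using (parent; parent≤; values-lower-bound)
        tree = Forest.forest parent parent≤
        k , size = values-finite tree (suc α) (suc β)
    in tree , k , size , subst (λ e → n ^ e ≤ c ^ suc (α + β) * k) (sym (ℕ.+-suc α β))
         (power-bound c (suc q) (suc (α + β)) n≤cq (values-lower-bound size))
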